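{- Let $\mathcal{V}$ be a variety of a fixed plural algebraic type (possibly containing constant symbols). Then: (1) if $\mathcal{V}$ is irregular, then for every subvariety $\mathcal{W}$ of $\mathcal{V}$, $R(\mathcal{W})$ covers $\mathcal{W}$ in the lattice $\mathbf{L}(R(\mathcal{V}))$ of subvarieties of $R(\mathcal{V})$; (2) if $\mathcal{V}$ is strongly irregular, then the map $h$ defined by $\mathcal{W}\mapsto R(\mathcal{W})$ is a lattice embedding of $\mathbf{L}(\mathcal{V})$ into $\mathbf{L}(R(\mathcal{V}))$.
   Context: A type is plural if it contains at least one operation symbol of arity at least $2$; it may contain constant symbols. An identity $\varphi\approx\psi$ is regular if the same variables occur in $\varphi$ and $\psi$, i.e. $Var(\varphi)=Var(\psi)$, and irregular otherwise. A variety is regular if it satisfies only regular identities, and irregular otherwise. A variety $\mathcal{V}$ is strongly irregular if there is a binary term $f(x,y)$, in which both $x$ and $y$ actually occur, such that $\mathcal{V}\models f(x,y)\approx x$. The regularization $R(\mathcal{V})$ of $\mathcal{V}$ is the variety (of the same type) defined by all regular identities holding in $\mathcal{V}$. $\mathbf{L}(\mathcal{V})$ denotes the lattice of subvarieties of $\mathcal{V}$ ordered by inclusion. In a lattice, $b$ covers $a$ if $a<b$ and there is no $c$ with $a<c<b$. -}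

module Defs where

open import Algebra.Lattice.Bundles using (RawLattice)
import Algebra.Lattice.Bundles as Alg
open import Data.Fin.Base using (Fin)
open import Data.Nat.Base using (ℕ; _≤_)
open import Data.Product.Base using (Σ-syntax; ∃-syntax; _×_; _,_; proj₁; proj₂; swap)
open import Data.Sum.Base using (inj₁; inj₂; [_,_])
open import Data.Vec.Functional using (Vector)
open import Function.Base using (_∘_; id)
open import Function.Bundles using (_⇔_; mk⇔; module Equivalence)
open import Level using (Level; suc; 0ℓ)
open import Relation.Binary.Bundles using (Setoid; Poset)
open import Relation.Binary.Lattice.Bundles using (Lattice)
import Relation.Binary.Lattice.Properties.Lattice as LatticeProperties
import Relation.Binary.Properties.Poset as PosetProperties
open import Relation.Nullary.Negation.Core using (¬_)
open import Relation.Unary using (Pred; _∈_; _⊆′_; _≐_; _≐′_; _∩_; _∪_; ｛_｝; ⋃)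

private
  variable
    a ℓ ℓ₁ ℓ₂ : Level

Covers : (P : Poset a ℓ₁ ℓ₂) → Poset.Carrier P → Poset.Carrier P → Set _
Covers P b a = a < b × ¬ (∃[ c ] (a < c × c < b))
  where open PosetProperties P using (_<_)

-- The algebraic (raw) lattice underlying an order-theoretic one, as
-- required by the stdlib notion of lattice morphism.
rawLattice : Lattice a ℓ₁ ℓ₂ → RawLattice a ℓ₁
rawLattice L = Alg.Lattice.rawLattice (LatticeProperties.algLattice L)

-- Constant symbols are the operation symbols of arity 0.
record AlgebraicType (ℓ : Level) : Set (suc ℓ) where
  field
    Op    : Set ℓ
    arity : Op → ℕ

open AlgebraicType public

Plural : AlgebraicType ℓ → Set ℓ
Plural τ = ∃[ o ] (2 ≤ arity τ o)

data Term (τ : AlgebraicType ℓ) : Set ℓ where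
  var : ℕ → Term τ
  op  : (o : Op τ) → Vector (Term τ) (arity τ o) → Term τ

module _ {τ : AlgebraicType ℓ} where

  Var : Term τ → Pred ℕ 0ℓ
  Var (var x)   = ｛ x ｝
  Var (op o ts) = ⋃ (Fin (arity τ o)) (λ i → Var (ts i))

  eval : {A : Set a} → ((o : Op τ) → Vector A (arity τ o) → A) →
         (ℕ → A) → Term τ → A
  eval f ρ (var x)   = ρ x
  eval f ρ (op o ts) = f o (λ i → eval f ρ (ts i))

  infix 9 _[_]

  _[_] : Term τ → (ℕ → Term τ) → Term τ
  t [ σ ] = eval op σ t

infix 5 _≋_

record Identity (τ : AlgebraicType ℓ) : Set ℓ where
  constructor _≋_
  field
    lhs rhs : Term τ

Regular : {τ : AlgebraicType ℓ} → Pred (Identity τ) 0ℓ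
Regular (p ≋ q) = Var p ≐ Var q

-- Equality in an algebra is an arbitrary equivalence relation respected
-- by the operations, which makes quotients available.
record Algebra (τ : AlgebraicType ℓ) : Set (suc ℓ) where
  field
    setoid : Setoid ℓ ℓ

  open Setoid setoid public

  field
    inhabitant  : Carrier
    interp      : (o : Op τ) → Vector Carrier (arity τ o) → Carrier
    interp-cong : ∀ o {xs ys} → (∀ i → xs i ≈ ys i) → interp o xs ≈ interp o ys

module _ {τ : AlgebraicType ℓ} where

  infix 4 _⊨_ _⊨*_ _⊩_

  _⊨_ : Algebra τ → Identity τ → Set ℓ
  A ⊨ p ≋ q = ∀ ρ → eval interp ρ p ≈ eval interp ρ q
    where open Algebra A

  _⊨*_ : Algebra τ → Pred (Identity τ) ℓ → Set ℓ
  A ⊨* E = ∀ i → i ∈ E → A ⊨ i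

  _⊩_ : Pred (Algebra τ) (suc ℓ) → Identity τ → Set (suc ℓ)
  K ⊩ i = ∀ A → A ∈ K → A ⊨ i

-- A variety is a class of algebras definable by a set of identities.
-- The set of axioms is required to be small (it lives at the level of the
-- algebras), so that relatively free algebras exist; the particular axioms
-- chosen are irrelevant, as varieties are only ever compared by their classes.
record Variety (τ : AlgebraicType ℓ) : Set (suc (suc ℓ)) where
  field
    class   : Pred (Algebra τ) (suc ℓ)
    axioms  : Pred (Identity τ) ℓ
    defines : ∀ A → A ∈ class ⇔ A ⊨* axioms

open Variety public

-- Birkhoff's completeness theorem is needed only to see that classes
-- defined by "all identities valid in ..." have a small set of axioms.

module _ {τ : AlgebraicType ℓ} where

  infix 4 _⊢_≈_

  data _⊢_≈_ (E : Pred (Identity τ) ℓ) : Term τ → Term τ → Set ℓ where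
    refl  : ∀ {p} → E ⊢ p ≈ p
    sym   : ∀ {p q} → E ⊢ p ≈ q → E ⊢ q ≈ p
    trans : ∀ {p q r} → E ⊢ p ≈ q → E ⊢ q ≈ r → E ⊢ p ≈ r
    cong  : ∀ o {ps qs} → (∀ i → E ⊢ ps i ≈ qs i) → E ⊢ op o ps ≈ op o qs
    ax    : ∀ {p q} → E (p ≋ q) → ∀ σ → E ⊢ p [ σ ] ≈ q [ σ ]

  Derivable : Pred (Identity τ) ℓ → Pred (Identity τ) ℓ
  Derivable E (p ≋ q) = E ⊢ p ≈ q

  module _ (A : Algebra τ) where
    open Algebra A using (_≈_; Carrier; interp; interp-cong)
    private module A = Algebra A

    eval-[] : ∀ (ρ : ℕ → Carrier) σ t →
              eval interp ρ (t [ σ ]) ≈ eval interp (eval interp ρ ∘ σ) t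
    eval-[] ρ σ (var x)   = A.refl
    eval-[] ρ σ (op o ts) = interp-cong o (λ i → eval-[] ρ σ (ts i))

    soundness : ∀ {E} → A ⊨* E → ∀ {p q} → E ⊢ p ≈ q → A ⊨ p ≋ q
    soundness m refl                 ρ = A.refl
    soundness m (sym d)              ρ = A.sym (soundness m d ρ)
    soundness m (trans d e)          ρ = A.trans (soundness m d ρ) (soundness m e ρ)
    soundness m (cong o ds)          ρ = interp-cong o (λ i → soundness m (ds i) ρ)
    soundness m (ax {p} {q} e σ)     ρ =
      A.trans (eval-[] ρ σ p) (A.trans (m _ e _) (A.sym (eval-[] ρ σ q)))

  free : Pred (Identity τ) ℓ → Algebra τ
  free E = record
    { setoid = record
      { Carrier       = Term τ
      ; _≈_           = E ⊢_≈_
      ; isEquivalence = record { refl = refl ; sym = sym ; trans = trans }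
      }
    ; inhabitant  = var 0
    ; interp      = op
    ; interp-cong = cong
    }

  [var]-id : ∀ {E} t → E ⊢ t [ var ] ≈ t
  [var]-id (var x)   = refl
  [var]-id (op o ts) = cong o (λ i → [var]-id (ts i))

  module _ (V : Variety τ) where

    valid⇒derivable : ∀ i → class V ⊩ i → i ∈ Derivable (axioms V)
    valid⇒derivable (p ≋ q) v =
      trans (sym ([var]-id p)) (trans (v (free (axioms V)) free∈V var) ([var]-id q))
      where
      free∈V : free (axioms V) ∈ class V
      free∈V = Equivalence.from (defines V _) (λ { (_ ≋ _) → ax })

    derivable⇒valid : ∀ i → i ∈ Derivable (axioms V) → class V ⊩ i
    derivable⇒valid (_ ≋ _) d A A∈V = soundness A (Equivalence.to (defines V A) A∈V) d

  RegularVariety : Variety τ → Set (suc ℓ)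
  RegularVariety V = ∀ i → class V ⊩ i → Regular i

  Irregular : Variety τ → Set (suc ℓ)
  Irregular V = ¬ RegularVariety V

  StronglyIrregular : Variety τ → Set (suc ℓ)
  StronglyIrregular V =
    Σ[ f ∈ Term τ ] (Var f ≐ ｛ 0 ｝ ∪ ｛ 1 ｝) × (class V ⊩ f ≋ var 0)

  R : Variety τ → Variety τ
  R V = record
    { class   = λ A → ∀ i → Regular i → class V ⊩ i → A ⊨ i
    ; axioms  = Regular ∩ Derivable (axioms V)
    ; defines = λ A → mk⇔
        (λ { m i (r , d) → m i r (derivable⇒valid V i d) })
        (λ m i r v → m i (r , valid⇒derivable V i v))
    }

  V⊆R : (V : Variety τ) → class V ⊆′ class (R V)
  V⊆R V A A∈V i r v = v A A∈V

  R-mono : (W V : Variety τ) → class W ⊆′ class V → class (R W) ⊆′ class (R V)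
  R-mono W V W⊆V A A∈RW i r v = A∈RW i r (λ B B∈W → v B (W⊆V B B∈W))

  meet : Variety τ → Variety τ → Variety τ
  meet U W = record
    { class   = class U ∩ class W
    ; axioms  = axioms U ∪ axioms W
    ; defines = λ A → mk⇔
        (λ { (A∈U , A∈W) i → [ to (defines U A) A∈U i , to (defines W A) A∈W i ] })
        (λ m → from (defines U A) (λ i → m i ∘ inj₁)
             , from (defines W A) (λ i → m i ∘ inj₂))
    }
    where open Equivalence

  -- The least variety containing both: the models of the common identities.
  join : Variety τ → Variety τ → Variety τ
  join U W = record
    { class   = λ A → ∀ i → class U ⊩ i → class W ⊩ i → A ⊨ i
    ; axioms  = Derivable (axioms U) ∩ Derivable (axioms W)
    ; defines = λ A → mk⇔
        (λ { m i (d , e) → m i (derivable⇒valid U i d) (derivable⇒valid W i e) })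
        (λ m i u w → m i (valid⇒derivable U i u , valid⇒derivable W i w))
    }

  join-least : (U W Z : Variety τ) → class U ⊆′ class Z → class W ⊆′ class Z →
               class (join U W) ⊆′ class Z
  join-least U W Z U⊆Z W⊆Z A A∈J = from (defines Z A)
    (λ i e → A∈J i (λ B B∈U → to (defines Z B) (U⊆Z B B∈U) i e)
                   (λ B B∈W → to (defines Z B) (W⊆Z B B∈W) i e))
    where open Equivalence

  Subvariety : Variety τ → Set (suc (suc ℓ))
  Subvariety V = Σ[ W ∈ Variety τ ] (class W ⊆′ class V)

  𝐋 : Variety τ → Lattice (suc (suc ℓ)) (suc ℓ) (suc ℓ)
  𝐋 V = record
    { Carrier   = Subvariety V
    ; _≈_       = λ (U , _) (W , _) → class U ≐′ class W
    ; _≤_       = λ (U , _) (W , _) → class U ⊆′ class W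
    ; _∨_       = λ (U , U⊆V) (W , W⊆V) → join U W , join-least U W V U⊆V W⊆V
    ; _∧_       = λ (U , U⊆V) (W , W⊆V) → meet U W , λ A → U⊆V A ∘ proj₁
    ; isLattice = record
      { isPartialOrder = record
        { isPreorder = record
          { isEquivalence = record
            { refl  = (λ A → id) , (λ A → id)
            ; sym   = swap
            ; trans = λ (f , g) (f′ , g′) → (λ A → f′ A ∘ f A) , (λ A → g A ∘ g′ A)
            }
          ; reflexive = proj₁
          ; trans     = λ f g A → g A ∘ f A
          }
        ; antisym = _,_
        }
      ; supremum = λ (U , _) (W , _) →
            (λ A A∈U i u w → u A A∈U)
          , (λ A A∈W i u w → w A A∈W)
          , (λ (Z , _) → join-least U W Z)
      ; infimum  = λ _ _ → (λ A → proj₁) , (λ A → proj₂) , (λ _ f g A A∈Z → f A A∈Z , g A A∈Z)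
      }
    }

  asSubvariety : (V : Variety τ) → Subvariety V → Subvariety (R V)
  asSubvariety V (W , W⊆V) = W , λ A → V⊆R V A ∘ W⊆V A

  h : (V : Variety τ) → Subvariety V → Subvariety (R V)
  h V (W , W⊆V) = R W , R-mono W V W⊆V

{-# OPTIONS --safe #-}

-- (1) Let W ⊆ C ⊆ R W, where C satisfies p ≈ q with a variable x of p not in q.
-- Writing p(a, b) for p with x replaced by a and every other variable by b,
-- C satisfies p(a, b) ≈ p(c, b).  If W satisfies s ≈ t and Var t ⊆ Var s, let
-- σ_u replace by u the variables outside t, so that s[σ_u] ≈ t holds in W; then
--   s ≈ s[σ_p(s,t)] ≈ s[σ_p(t,t)] ≈ t
-- in C, the outer identities being regular identities of W.  An arbitrary
-- identity of W is split by a term containing the variables of both sides, so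
-- C = W.
--
-- (2) If V satisfies f(x, y) ≈ x, then s ≈ t amounts in V to the regular
-- identity f(s, t) ≈ f(t, s), whence W = V ∩ R W.  For meets, let A lie in
-- R U ∩ R W, let s be a term and fix an assignment in A.  The terms over Var s,
-- with p and q identified when f(p, s) and f(q, s) have equal values, form an
-- algebra in U ∩ W (it plays the role of a fibre of the Płonka sum).

module Submission where

open import Defs
open import Algebra.Lattice.Morphism.Structures using (module LatticeMorphisms)
open import Data.Empty using (⊥-elim)
open import Data.Fin.Base using (Fin; zero; suc)
open import Data.Fin.Properties using (any?)
open import Data.Nat.Base using (ℕ; zero; suc; _≤_; s≤s)
open import Data.Nat.Properties using (_≟_)
open import Data.Product.Base using (Σ-syntax; ∃-syntax; _×_; _,_; proj₁; proj₂)
open import Data.Sum.Base using (_⊎_; inj₁; inj₂; [_,_]′)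
open import Data.Vec.Functional using (Vector; _∷_)
open import Function.Base using (_∘_; _∘′_; id)
open import Function.Bundles using (module Equivalence)
open import Level using (Level; 0ℓ)
open import Relation.Binary.Lattice.Bundles using (module Lattice)
open import Relation.Binary.PropositionalEquality.Core as ≡ using (_≡_)
import Relation.Binary.Reasoning.Setoid as ≈-Reasoning
open import Relation.Nullary.Decidable using (Dec; yes; no; map′; ¬?; decidable-stable)
open import Relation.Nullary.Negation using (¬_)
open import Relation.Unary using (Pred; Decidable; _∈_; _∉_; _⊆_; _⊆′_; _≐_; _∪_; ｛_｝)

private
  variable
    ℓ : Level

module _ {τ : AlgebraicType ℓ} where

  -- Decidable occurrence of variables in terms.

  anyVar? : {P : Pred ℕ 0ℓ} → Decidable P → ∀ t → Dec (∃[ x ] (x ∈ Var {τ = τ} t × P x))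
  anyVar? {P} P? (var y) =
    map′ (λ Py → y , ≡.refl , Py) (λ { (_ , ≡.refl , Py) → Py }) (P? y)
  anyVar? P? (op o ts) =
    map′ (λ (i , x , x∈ , Px) → x , (i , x∈) , Px)
         (λ (x , (i , x∈) , Px) → i , x , x∈ , Px)
         (any? (λ i → anyVar? P? (ts i)))

  var∈? : ∀ (t : Term τ) → Decidable (Var t)
  var∈? t x = map′ (λ { (_ , x∈ , ≡.refl) → x∈ }) (λ x∈ → x , x∈ , ≡.refl)
                   (anyVar? (x ≟_) t)

  Var-⊆⊎⊈ : ∀ (p q : Term τ) → Var p ⊆ Var q ⊎ ∃[ x ] (x ∈ Var p × x ∉ Var q)
  Var-⊆⊎⊈ p q with anyVar? (¬? ∘ var∈? q) p
  ... | yes escapes = inj₂ escapes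
  ... | no  none    =
    inj₁ (λ {x} x∈p → decidable-stable (var∈? q x) (λ x∉q → none (x , x∈p , x∉q)))

  -- Variables under substitution, and regularity of `R W`.

  Var-[]⁺ : ∀ (t : Term τ) {σ : ℕ → Term τ} {x y} →
            x ∈ Var t → y ∈ Var (σ x) → y ∈ Var (t [ σ ])
  Var-[]⁺ (var _)   ≡.refl   y∈ = y∈
  Var-[]⁺ (op o ts) (i , x∈) y∈ = i , Var-[]⁺ (ts i) x∈ y∈

  Var-[]⁻ : ∀ (t : Term τ) {σ : ℕ → Term τ} {y} →
            y ∈ Var (t [ σ ]) → ∃[ x ] (x ∈ Var t × y ∈ Var (σ x))
  Var-[]⁻ (var x)   y∈       = x , ≡.refl , y∈
  Var-[]⁻ (op o ts) (i , y∈) = let x , x∈ , y∈σx = Var-[]⁻ (ts i) y∈ in x , (i , x∈) , y∈σx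

  Var-[]-mono : ∀ (p q : Term τ) {σ : ℕ → Term τ} →
                Var p ⊆ Var q → Var (p [ σ ]) ⊆ Var (q [ σ ])
  Var-[]-mono p q p⊆q y∈ = let _ , x∈ , y∈σx = Var-[]⁻ p y∈ in Var-[]⁺ q (p⊆q x∈) y∈σx

  -- Induction on the derivation: an axiom instance keeps equal variable sets because substitution
  -- is monotone in the variables of a term.
  ⊢-regular : ∀ {E} → E ⊆ Regular → ∀ {p q : Term τ} → E ⊢ p ≈ q → Var p ≐ Var q
  ⊢-regular r refl        = id , id
  ⊢-regular r (sym d)     = let f , g = ⊢-regular r d in g , f
  ⊢-regular r (trans d e) =
    let f , g = ⊢-regular r d ; f′ , g′ = ⊢-regular r e in (λ x∈ → f′ (f x∈)) , (λ x∈ → g (g′ x∈))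
  ⊢-regular r (cong o ds) =
      (λ (i , x∈) → i , proj₁ (⊢-regular r (ds i)) x∈)
    , (λ (i , x∈) → i , proj₂ (⊢-regular r (ds i)) x∈)
  ⊢-regular r (ax {p} {q} e σ) =
    Var-[]-mono p q (proj₁ (r e)) , Var-[]-mono q p (proj₂ (r e))

  R-regular : ∀ (W : Variety τ) → RegularVariety (R W)
  R-regular W (p ≋ q) v = ⊢-regular proj₁ (valid⇒derivable (R W) (p ≋ q) v)

  module _ (A : Algebra τ) where
    open Algebra A using (_≈_; Carrier; interp; interp-cong)

    eval-cong : ∀ {ρ ρ′ : ℕ → Carrier} t → (∀ {x} → x ∈ Var t → ρ x ≈ ρ′ x) →
                eval interp ρ t ≈ eval interp ρ′ t
    eval-cong (var x)   ρ≈ρ′ = ρ≈ρ′ ≡.refl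
    eval-cong (op o ts) ρ≈ρ′ = interp-cong o (λ i → eval-cong (ts i) (λ x∈ → ρ≈ρ′ (i , x∈)))

  ⊆-fromIdentities : ∀ (C W : Variety τ) → (∀ i → class W ⊩ i → class C ⊩ i) → class C ⊆′ class W
  ⊆-fromIdentities C W valid A A∈C = Equivalence.from (defines W A)
    (λ i i∈E → valid i (λ B B∈W → Equivalence.to (defines W B) B∈W i i∈E) A A∈C)

  -- Substitutions that are constant outside a decidable set.

  module _ {P : Pred ℕ 0ℓ} (P? : Decidable P) (σ : ℕ → Term τ) (u : Term τ) where

    override : ℕ → Term τ
    override x with P? x
    ... | yes _ = σ x
    ... | no  _ = u

    override-∈ : ∀ {x} → x ∈ P → override x ≡ σ x
    override-∈ {x} x∈P with P? x
    ... | yes _   = ≡.refl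
    ... | no  x∉P = ⊥-elim (x∉P x∈P)

    override-∉ : ∀ {x} → x ∉ P → override x ≡ u
    override-∉ {x} x∉P with P? x
    ... | yes x∈P = ⊥-elim (x∉P x∈P)
    ... | no  _   = ≡.refl

    Var-override : ∀ x {y} → y ∈ Var (override x) → (x ∈ P × y ∈ Var (σ x)) ⊎ y ∈ Var u
    Var-override x y∈ with P? x
    ... | yes x∈P = inj₁ (x∈P , y∈)
    ... | no  _   = inj₂ y∈

  replaceOutside : Term τ → Term τ → ℕ → Term τ
  replaceOutside t = override (var∈? t) var

  -- Applied to p, this yields the term written p(a, b). With `x` = 0 it also gives the binary f(p,
  -- q), since `f` has only the variables 0 and 1.
  specialise : ℕ → Term τ → Term τ → ℕ → Term τ
  specialise x a b = override (x ≟_) (λ _ → a) b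

  module _ (p : Term τ) (x : ℕ) (a b : Term τ) where

    Var-specialise⁻ : Var (p [ specialise x a b ]) ⊆ Var a ∪ Var b
    Var-specialise⁻ y∈ with Var-[]⁻ p y∈
    ... | z , _ , y∈σz with Var-override (x ≟_) (λ _ → a) b z y∈σz
    ...   | inj₁ (_ , y∈a) = inj₁ y∈a
    ...   | inj₂ y∈b       = inj₂ y∈b

    Var-specialise⁺ˡ : x ∈ Var p → Var a ⊆ Var (p [ specialise x a b ])
    Var-specialise⁺ˡ x∈p {y} y∈a = Var-[]⁺ p x∈p
      (≡.subst (λ u → y ∈ Var u) (≡.sym (override-∈ (x ≟_) (λ _ → a) b ≡.refl)) y∈a)

    Var-specialise⁺ʳ : ∀ {z} → ¬ x ≡ z → z ∈ Var p → Var b ⊆ Var (p [ specialise x a b ])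
    Var-specialise⁺ʳ x≢z z∈p {y} y∈b = Var-[]⁺ p z∈p
      (≡.subst (λ u → y ∈ Var u) (≡.sym (override-∉ (x ≟_) (λ _ → a) b x≢z)) y∈b)

  Var-replaceOutside⁻ : ∀ (s t u : Term τ) → Var (s [ replaceOutside t u ]) ⊆ Var t ∪ Var u
  Var-replaceOutside⁻ s t u y∈ with Var-[]⁻ s y∈
  ... | z , _ , y∈σz with Var-override (var∈? t) var u z y∈σz
  ...   | inj₁ (z∈t , ≡.refl) = inj₁ z∈t
  ...   | inj₂ y∈u            = inj₂ y∈u

  Var-replaceOutside⁺ : ∀ (s t u : Term τ) {x} → x ∈ Var s → (x ∉ Var t → x ∈ Var u) →
                        x ∈ Var (s [ replaceOutside t u ])
  Var-replaceOutside⁺ s t u {x} x∈s outside = Var-[]⁺ s x∈s x∈σx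
    where
    x∈σx : x ∈ Var (replaceOutside t u x)
    x∈σx with var∈? t x
    ... | yes _   = ≡.refl
    ... | no  x∉t = outside x∉t

  -- Evaluation of substituted terms.

  module _ (A : Algebra τ) where
    open Algebra A using (_≈_; Carrier; interp)
    private module A = Algebra A

    eval-[]-cong : ∀ (ρ : ℕ → Carrier) t {σ σ′} →
                   (∀ {x} → x ∈ Var t → eval interp ρ (σ x) ≈ eval interp ρ (σ′ x)) →
                   eval interp ρ (t [ σ ]) ≈ eval interp ρ (t [ σ′ ])
    eval-[]-cong ρ t {σ} {σ′} eq = A.trans (eval-[] A ρ σ t)
      (A.trans (eval-cong A t eq) (A.sym (eval-[] A ρ σ′ t)))

    eval-[]-fix : ∀ (ρ : ℕ → Carrier) t {σ} →
                  (∀ {x} → x ∈ Var t → σ x ≡ var x) →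
                  eval interp ρ (t [ σ ]) ≈ eval interp ρ t
    eval-[]-fix ρ t {σ} eq = A.trans (eval-[] A ρ σ t)
      (eval-cong A t (λ x∈ → A.reflexive (≡.cong (eval interp ρ) (eq x∈))))

    ⊨-[] : ∀ p q → A ⊨ p ≋ q → ∀ σ → A ⊨ p [ σ ] ≋ q [ σ ]
    ⊨-[] p q p≈q σ ρ =
      A.trans (eval-[] A ρ σ p) (A.trans (p≈q _) (A.sym (eval-[] A ρ σ q)))

    -- Both sides are compared with instances of `q`, which coincide because `q` does not contain
    -- the only variable at which the two substitutions differ.
    ⊨-specialise : ∀ p q {x} → A ⊨ p ≋ q → x ∉ Var q → ∀ a b c →
                   A ⊨ p [ specialise x a b ] ≋ p [ specialise x c b ]
    ⊨-specialise p q {x} p≈q x∉q a b c ρ = begin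
      eval interp ρ (p [ specialise x a b ]) ≈⟨ ⊨-[] p q p≈q (specialise x a b) ρ ⟩
      eval interp ρ (q [ specialise x a b ]) ≈⟨ eval-[]-cong ρ q same ⟩
      eval interp ρ (q [ specialise x c b ]) ≈⟨ ⊨-[] p q p≈q (specialise x c b) ρ ⟨
      eval interp ρ (p [ specialise x c b ]) ∎
      where
      open ≈-Reasoning A.setoid
      same : ∀ {y} → y ∈ Var q →
             eval interp ρ (specialise x a b y) ≈ eval interp ρ (specialise x c b y)
      same {y} y∈q with x ≟ y
      ... | yes ≡.refl = ⊥-elim (x∉q y∈q)
      ... | no  _      = A.refl

    ⊨-replaceOutside-cong : ∀ s t {u u′} → A ⊨ u ≋ u′ →
                            A ⊨ s [ replaceOutside t u ] ≋ s [ replaceOutside t u′ ]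
    ⊨-replaceOutside-cong s t {u} {u′} u≈u′ ρ = eval-[]-cong ρ s same
      where
      same : ∀ {x} → x ∈ Var s →
             eval interp ρ (replaceOutside t u x) ≈ eval interp ρ (replaceOutside t u′ x)
      same {x} _ with var∈? t x
      ... | yes _ = A.refl
      ... | no  _ = u≈u′ ρ

    ⊨-replaceOutside : ∀ s t → A ⊨ s ≋ t → ∀ u → A ⊨ s [ replaceOutside t u ] ≋ t
    ⊨-replaceOutside s t s≈t u ρ = A.trans (⊨-[] s t s≈t (replaceOutside t u) ρ)
      (eval-[]-fix ρ t (override-∈ (var∈? t) var u))

  -- Plurality enters here: the operation takes `s` in its first place and `t` in all others, of
  -- which there is at least one.
  amalgam : Plural τ → ∀ (s t : Term τ) → Σ[ u ∈ Term τ ] (Var u ≐ Var s ∪ Var t)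
  amalgam (o , 2≤n) s t = op o (args 2≤n) , ⊆∪ 2≤n , ∪⊆ 2≤n
    where
    -- The arity is generalised to `n` so that matching on the inequality can refine it; `arity τ o`
    -- does not unify with a successor.
    args : ∀ {n} → 2 ≤ n → Vector (Term τ) n
    args (s≤s _) = s ∷ λ _ → t

    ⊆∪ : ∀ {n} (2≤n : 2 ≤ n) {y} → Σ[ i ∈ Fin n ] y ∈ Var (args 2≤n i) → y ∈ Var s ∪ Var t
    ⊆∪ (s≤s _) (zero  , y∈s) = inj₁ y∈s
    ⊆∪ (s≤s _) (suc _ , y∈t) = inj₂ y∈t

    ∪⊆ : ∀ {n} (2≤n : 2 ≤ n) {y} → y ∈ Var s ∪ Var t → Σ[ i ∈ Fin n ] y ∈ Var (args 2≤n i)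
    ∪⊆ (s≤s _)       (inj₁ y∈s) = zero , y∈s
    ∪⊆ (s≤s (s≤s _)) (inj₂ y∈t) = suc zero , y∈t

  -- One irregular identity forces all identities of `W`.

  module Collapse (plural : Plural τ) (C W : Variety τ) (C⊆RW : class C ⊆′ class (R W))
                  (p q : Term τ) (C⊩p≈q : class C ⊩ p ≋ q)
                  {x : ℕ} (x∈p : x ∈ Var p) (x∉q : x ∉ Var q) where

    -- The outer identities hold in `W` since `σ` fixes the variables of `t`. They are regular since
    -- p(s, t) has exactly the variables of `s`, while p(t, t) introduces none outside `t`.
    collapse-⊆ : ∀ s t → Var t ⊆ Var s → class W ⊩ s ≋ t → class C ⊩ s ≋ t
    collapse-⊆ s t t⊆s s≈t A A∈C ρ = begin
      eval interp ρ s
        ≈⟨ A∈RW (s ≋ s [ σ p⟨ s ⟩ ]) (s⊆ , ⊆s) s≈ ρ ⟩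
      eval interp ρ (s [ σ p⟨ s ⟩ ])
        ≈⟨ ⊨-replaceOutside-cong A s t p⟨s⟩≈p⟨t⟩ ρ ⟩
      eval interp ρ (s [ σ p⟨ t ⟩ ])
        ≈⟨ A∈RW (s [ σ p⟨ t ⟩ ] ≋ t) (⊆t , t⊆) ≈t ρ ⟩
      eval interp ρ t
        ∎
      where
      open Algebra A using (setoid; interp)
      open ≈-Reasoning setoid

      A∈RW : A ∈ class (R W)
      A∈RW = C⊆RW A A∈C

      σ : Term τ → ℕ → Term τ
      σ = replaceOutside t

      p⟨_⟩ : Term τ → Term τ
      p⟨ a ⟩ = p [ specialise x a t ]

      p⟨s⟩≈p⟨t⟩ : A ⊨ p⟨ s ⟩ ≋ p⟨ t ⟩
      p⟨s⟩≈p⟨t⟩ = ⊨-specialise A p q (C⊩p≈q A A∈C) x∉q s t t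

      s≈ : class W ⊩ s ≋ s [ σ p⟨ s ⟩ ]
      s≈ B B∈W ρ = B.trans (s≈t B B∈W ρ) (B.sym (⊨-replaceOutside B s t (s≈t B B∈W) p⟨ s ⟩ ρ))
        where module B = Algebra B

      ≈t : class W ⊩ s [ σ p⟨ t ⟩ ] ≋ t
      ≈t B B∈W = ⊨-replaceOutside B s t (s≈t B B∈W) p⟨ t ⟩

      s⊆ : Var s ⊆ Var (s [ σ p⟨ s ⟩ ])
      s⊆ y∈s = Var-replaceOutside⁺ s t p⟨ s ⟩ y∈s (λ _ → Var-specialise⁺ˡ p x s t x∈p y∈s)

      ⊆s : Var (s [ σ p⟨ s ⟩ ]) ⊆ Var s
      ⊆s = [ t⊆s , [ id , t⊆s ]′ ∘′ Var-specialise⁻ p x s t ]′ ∘′ Var-replaceOutside⁻ s t p⟨ s ⟩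

      ⊆t : Var (s [ σ p⟨ t ⟩ ]) ⊆ Var t
      ⊆t = [ id , [ id , id ]′ ∘′ Var-specialise⁻ p x t t ]′ ∘′ Var-replaceOutside⁻ s t p⟨ t ⟩

      t⊆ : Var t ⊆ Var (s [ σ p⟨ t ⟩ ])
      t⊆ y∈t = Var-replaceOutside⁺ s t p⟨ t ⟩ (t⊆s y∈t) (λ y∉t → ⊥-elim (y∉t y∈t))

    collapse : ∀ i → class W ⊩ i → class C ⊩ i
    collapse (s ≋ t) s≈t with Var-⊆⊎⊈ s t
    ... | inj₁ s⊆t = λ A A∈C ρ →
      Algebra.sym A (collapse-⊆ t s s⊆t (λ B B∈W ρ′ → Algebra.sym B (s≈t B B∈W ρ′)) A A∈C ρ)
    ... | inj₂ (y , y∈s , y∉t) = λ A A∈C ρ → Algebra.trans A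
      (Algebra.sym A (collapse-⊆ m s s⊆m m≈s A A∈C ρ)) (collapse-⊆ m t t⊆m m≈t A A∈C ρ)
      where
      u m : Term τ
      u = proj₁ (amalgam plural s t)
      -- As `y` occurs in `s` but not in `t`, a copy of `u` really appears in `m`; so `m` contains
      -- the variables of both sides and `collapse-⊆` applies to each.
      m = s [ replaceOutside t u ]

      m≈t : class W ⊩ m ≋ t
      m≈t B B∈W = ⊨-replaceOutside B s t (s≈t B B∈W) u

      m≈s : class W ⊩ m ≋ s
      m≈s B B∈W ρ = Algebra.trans B (m≈t B B∈W ρ) (Algebra.sym B (s≈t B B∈W ρ))

      u⊆m : Var u ⊆ Var m
      u⊆m {z} z∈u = Var-[]⁺ s y∈s
        (≡.subst (λ v → z ∈ Var v) (≡.sym (override-∉ (var∈? t) var u y∉t)) z∈u)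

      s⊆m : Var s ⊆ Var m
      s⊆m = u⊆m ∘′ proj₂ (proj₂ (amalgam plural s t)) ∘′ inj₁

      t⊆m : Var t ⊆ Var m
      t⊆m = u⊆m ∘′ proj₂ (proj₂ (amalgam plural s t)) ∘′ inj₂

  -- The covering relation.

  ⊆⇒regular : ∀ (C : Variety τ) → (∀ p q → class C ⊩ p ≋ q → Var p ⊆ Var q) → RegularVariety C
  ⊆⇒regular C lhs⊆rhs (p ≋ q) p≈q =
    lhs⊆rhs p q p≈q , lhs⊆rhs q p (λ A A∈C ρ → Algebra.sym A (p≈q A A∈C ρ))

  regular⇒R⊆ : ∀ (C W : Variety τ) → class W ⊆′ class C → RegularVariety C → class (R W) ⊆′ class C
  regular⇒R⊆ C W W⊆C C-reg = ⊆-fromIdentities (R W) C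
    (λ i C⊩i A A∈RW → A∈RW i (C-reg i C⊩i) (λ B B∈W → C⊩i B (W⊆C B B∈W)))

  -- Irregularity is a negation and supplies no explicit irregular identity, hence the double
  -- negation. This is enough to refute an intermediate variety.
  irregular⇒⊆ : Plural τ → ∀ (C W : Variety τ) → class C ⊆′ class (R W) →
                Irregular C → ¬ ¬ (class C ⊆′ class W)
  irregular⇒⊆ plural C W C⊆RW C-irr C⊈W = C-irr (⊆⇒regular C p⊆q)
    where
    p⊆q : ∀ p q → class C ⊩ p ≋ q → Var p ⊆ Var q
    p⊆q p q p≈q with Var-⊆⊎⊈ p q
    ... | inj₁ p⊆q = p⊆q
    ... | inj₂ (x , x∈p , x∉q) = ⊥-elim (C⊈W (⊆-fromIdentities C W
            (Collapse.collapse plural C W C⊆RW p q p≈q x∈p x∉q)))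

  R-covers : Plural τ → ∀ (V : Variety τ) → Irregular V → ∀ W →
             Covers (Lattice.poset (𝐋 (R V))) (h V W) (asSubvariety V W)
  -- If `R W` were equal to `W`, every identity of `V` would hold in `R W` and so be regular.
  R-covers plural V V-irr (W , W⊆V) = (V⊆R W , λ (_ , RW⊆W) → V-irr (λ i V⊩i →
      R-regular W i (λ A A∈RW → V⊩i A (W⊆V A (RW⊆W A A∈RW)))))
    -- An intermediate `C` cannot be regular, as it would contain `R W`; being irregular, it would
    -- lie in `W`.
    , λ ((C , _) , (W⊆C , W≉C) , (C⊆RW , C≉RW)) →
        irregular⇒⊆ plural C W C⊆RW
          (λ C-reg → C≉RW (C⊆RW , regular⇒R⊆ C W W⊆C C-reg))
          (λ C⊆W → W≉C (W⊆C , C⊆W))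

  -- Strong irregularity: injectivity of `h`.

  module StrongIrregularity (V : Variety τ) (f : Term τ) (f≐ : Var f ≐ ｛ 0 ｝ ∪ ｛ 1 ｝)
                            (f≈x : class V ⊩ f ≋ var 0) where

    private
      f⟨_,_⟩ : Term τ → Term τ → Term τ
      f⟨ p , q ⟩ = f [ specialise 0 p q ]

      Var-f⁻ : ∀ p q → Var f⟨ p , q ⟩ ⊆ Var p ∪ Var q
      Var-f⁻ p q = Var-specialise⁻ f 0 p q

      Var-f⁺ : ∀ p q → Var p ∪ Var q ⊆ Var f⟨ p , q ⟩
      Var-f⁺ p q (inj₁ x∈p) = Var-specialise⁺ˡ f 0 p q (proj₂ f≐ (inj₁ ≡.refl)) x∈p
      Var-f⁺ p q (inj₂ x∈q) = Var-specialise⁺ʳ f 0 p q (λ ()) (proj₂ f≐ (inj₂ ≡.refl)) x∈q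

      f-absorbs : ∀ p q → class V ⊩ f⟨ p , q ⟩ ≋ p
      f-absorbs p q A A∈V = ⊨-[] A f (var 0) (f≈x A A∈V) (specialise 0 p q)

    -- The identity f(s, t) ≈ f(t, s) is regular, so it passes from `W` to `R W`; absorption in `V`
    -- turns it back into s ≈ t.
    R∩V⊆ : ∀ (W : Variety τ) → class W ⊆′ class V →
           ∀ A → A ∈ class V → A ∈ class (R W) → A ∈ class W
    R∩V⊆ W W⊆V A A∈V A∈RW = Equivalence.from (defines W A) λ { (s ≋ t) s≈t∈E ρ →
      let
        s≈t : ∀ B → B ∈ class W → B ⊨ s ≋ t
        s≈t B B∈W = Equivalence.to (defines W B) B∈W (s ≋ t) s≈t∈E

        f-comm : class W ⊩ f⟨ s , t ⟩ ≋ f⟨ t , s ⟩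
        f-comm B B∈W ρ′ = Algebra.trans B (f-absorbs s t B (W⊆V B B∈W) ρ′)
          (Algebra.trans B (s≈t B B∈W ρ′)
            (Algebra.sym B (f-absorbs t s B (W⊆V B B∈W) ρ′)))

        regular : Regular (f⟨ s , t ⟩ ≋ f⟨ t , s ⟩)
        regular = Var-f⁺ t s ∘′ [ inj₂ , inj₁ ]′ ∘′ Var-f⁻ s t
                , Var-f⁺ s t ∘′ [ inj₂ , inj₁ ]′ ∘′ Var-f⁻ t s
      in Algebra.trans A (Algebra.sym A (f-absorbs s t A A∈V ρ))
           (Algebra.trans A (A∈RW (f⟨ s , t ⟩ ≋ f⟨ t , s ⟩) regular f-comm ρ)
             (f-absorbs t s A A∈V ρ)) }

    h-injective : ∀ (U W : Variety τ) → class U ⊆′ class V → class W ⊆′ class V →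
                  class (R U) ⊆′ class (R W) → class U ⊆′ class W
    h-injective U W U⊆V W⊆V RU⊆RW A A∈U =
      R∩V⊆ W W⊆V A (U⊆V A A∈U) (RU⊆RW A (V⊆R U A A∈U))

    -- The fibre over a term, and preservation of meets.

    module Fibre (A : Algebra τ) (A∈RV : A ∈ class (R V))
                 (ρ : ℕ → Algebra.Carrier A) (s : Term τ) where
      open Algebra A using (_≈_; interp; interp-cong; setoid)
      open ≈-Reasoning setoid
      private module A = Algebra A

      private
        ⟦_⟧ : Term τ → A.Carrier
        ⟦ t ⟧ = eval interp ρ t

      -- In `V` both sides equal `op o ps`, and their variables agree, so the identity passes to
      -- `R V`. It makes the operations of the fibre respect its equality.
      f-op : ∀ o ps → ⟦ f⟨ op o ps , s ⟩ ⟧ ≈ ⟦ f⟨ op o (λ i → f⟨ ps i , s ⟩) , s ⟩ ⟧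
      f-op o ps = A∈RV (f⟨ op o ps , s ⟩ ≋ f⟨ op o fps , s ⟩) (ops⊆ops′ , ops′⊆ops) valid ρ
        where
        fps : Vector (Term τ) (arity τ o)
        fps i = f⟨ ps i , s ⟩

        ops⊆ops′ : Var f⟨ op o ps , s ⟩ ⊆ Var f⟨ op o fps , s ⟩
        ops⊆ops′ = Var-f⁺ (op o fps) s
          ∘′ [ (λ (i , x∈) → inj₁ (i , Var-f⁺ (ps i) s (inj₁ x∈))) , inj₂ ]′
          ∘′ Var-f⁻ (op o ps) s

        ops′⊆ops : Var f⟨ op o fps , s ⟩ ⊆ Var f⟨ op o ps , s ⟩
        ops′⊆ops = Var-f⁺ (op o ps) s
          ∘′ [ (λ (i , x∈) → [ (λ x∈p → inj₁ (i , x∈p)) , inj₂ ]′ (Var-f⁻ (ps i) s x∈)) , inj₂ ]′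
          ∘′ Var-f⁻ (op o fps) s

        valid : class V ⊩ f⟨ op o ps , s ⟩ ≋ f⟨ op o fps , s ⟩
        valid B B∈V ρ′ = B.trans (f-absorbs (op o ps) s B B∈V ρ′)
          (B.trans (B.interp-cong o (λ i → B.sym (f-absorbs (ps i) s B B∈V ρ′)))
            (B.sym (f-absorbs (op o fps) s B B∈V ρ′)))
          where module B = Algebra B

      f-congˡ : ∀ {p q} → ⟦ p ⟧ ≈ ⟦ q ⟧ → ⟦ f⟨ p , s ⟩ ⟧ ≈ ⟦ f⟨ q , s ⟩ ⟧
      f-congˡ {p} {q} p≈q = eval-[]-cong A ρ f λ {x} _ → same x
        where
        same : ∀ x → ⟦ specialise 0 p s x ⟧ ≈ ⟦ specialise 0 q s x ⟧
        same zero    = p≈q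
        same (suc _) = A.refl

      -- For `p` over `Var s`, the term f(p, s) has exactly the variables of `s`, so identities
      -- between such terms are regular. Asking for inclusion rather than equality of variable sets
      -- admits constant symbols.
      fibre : Algebra τ
      fibre = record
        { setoid = record
          { Carrier = Σ[ p ∈ Term τ ] (Var p ⊆ Var s)
          ; _≈_ = λ (p , _) (q , _) → ⟦ f⟨ p , s ⟩ ⟧ ≈ ⟦ f⟨ q , s ⟩ ⟧
          ; isEquivalence = record { refl = A.refl ; sym = A.sym ; trans = A.trans }
          }
        ; inhabitant  = s , id
        ; interp      = λ o ps → op o (proj₁ ∘ ps) , λ (i , x∈) → proj₂ (ps i) x∈
        ; interp-cong = λ o {ps} {qs} ps≈qs → begin
            ⟦ f⟨ op o (proj₁ ∘ ps) , s ⟩ ⟧                  ≈⟨ f-op o (proj₁ ∘ ps) ⟩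
            ⟦ f⟨ op o (λ i → f⟨ proj₁ (ps i) , s ⟩) , s ⟩ ⟧ ≈⟨ f-congˡ (interp-cong o ps≈qs) ⟩
            ⟦ f⟨ op o (λ i → f⟨ proj₁ (qs i) , s ⟩) , s ⟩ ⟧ ≈⟨ f-op o (proj₁ ∘ qs) ⟨
            ⟦ f⟨ op o (proj₁ ∘ qs) , s ⟩ ⟧                  ∎
        }

      private module F = Algebra fibre

      eval-fibre : ∀ (σ : ℕ → F.Carrier) t →
                   ⟦ proj₁ (eval F.interp σ t) ⟧ ≈ ⟦ t [ proj₁ ∘ σ ] ⟧
      eval-fibre σ (var x)   = A.refl
      eval-fibre σ (op o ts) = interp-cong o (λ i → eval-fibre σ (ts i))

      -- An axiom instance wrapped as f(-, s) becomes a regular identity of `W`, hence holds in `A`;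
      -- this is precisely equality in the fibre.
      fibre∈ : ∀ (W : Variety τ) → class W ⊆′ class V → A ∈ class (R W) → fibre ∈ class W
      fibre∈ W W⊆V A∈RW = Equivalence.from (defines W fibre) λ { (p ≋ q) p≈q∈E σ →
        let
          _[σ] : Term τ → Term τ
          t [σ] = t [ proj₁ ∘ σ ]

          Var-[σ] : ∀ t → Var f⟨ t [σ] , s ⟩ ⊆ Var s
          Var-[σ] t = [ (λ x∈ → let y , _ , x∈σy = Var-[]⁻ t x∈ in proj₂ (σ y) x∈σy) , id ]′
            ∘′ Var-f⁻ (t [σ]) s

          regular : Regular (f⟨ p [σ] , s ⟩ ≋ f⟨ q [σ] , s ⟩)
          regular = Var-f⁺ (q [σ]) s ∘′ inj₂ ∘′ Var-[σ] p , Var-f⁺ (p [σ]) s ∘′ inj₂ ∘′ Var-[σ] q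

          valid : class W ⊩ f⟨ p [σ] , s ⟩ ≋ f⟨ q [σ] , s ⟩
          valid B B∈W ρ′ = Algebra.trans B (f-absorbs (p [σ]) s B (W⊆V B B∈W) ρ′)
            (Algebra.trans B
              (⊨-[] B p q (Equivalence.to (defines W B) B∈W (p ≋ q) p≈q∈E) (proj₁ ∘ σ) ρ′)
              (Algebra.sym B (f-absorbs (q [σ]) s B (W⊆V B B∈W) ρ′)))
        in begin
          ⟦ f⟨ proj₁ (eval F.interp σ p) , s ⟩ ⟧ ≈⟨ f-congˡ (eval-fibre σ p) ⟩
          ⟦ f⟨ p [σ] , s ⟩ ⟧                     ≈⟨ A∈RW (f⟨ p [σ] , s ⟩ ≋ f⟨ q [σ] , s ⟩) regular valid ρ ⟩
          ⟦ f⟨ q [σ] , s ⟩ ⟧                     ≈⟨ f-congˡ (eval-fibre σ q) ⟨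
          ⟦ f⟨ proj₁ (eval F.interp σ q) , s ⟩ ⟧ ∎ }

      -- Evaluate the identity at the assignment sending each variable of `s` to itself. The
      -- wrapping is then undone by f(s, s) ≈ s and f(t, s) ≈ t, regular identities of `V`.
      fibre-reflects : ∀ t → Var s ≐ Var t → fibre ⊨ s ≋ t → ⟦ s ⟧ ≈ ⟦ t ⟧
      fibre-reflects t (s⊆t , t⊆s) s≈t = begin
        ⟦ s ⟧                                  ≈⟨ f-s s id id ⟨
        ⟦ f⟨ s , s ⟩ ⟧                         ≈⟨ f-congˡ (eval-σ s id) ⟨
        ⟦ f⟨ proj₁ (eval F.interp σ s) , s ⟩ ⟧ ≈⟨ s≈t σ ⟩
        ⟦ f⟨ proj₁ (eval F.interp σ t) , s ⟩ ⟧ ≈⟨ f-congˡ (eval-σ t t⊆s) ⟩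
        ⟦ f⟨ t , s ⟩ ⟧                         ≈⟨ f-s t t⊆s s⊆t ⟩
        ⟦ t ⟧                                  ∎
        where
        σ : ℕ → F.Carrier
        -- A variable outside `s` is no element of the fibre, so `s` itself is the default value.
        σ x = replaceOutside s s x
            , [ (λ { (x∈s , ≡.refl) → x∈s }) , id ]′ ∘′ Var-override (var∈? s) var s x

        eval-σ : ∀ u → Var u ⊆ Var s → ⟦ proj₁ (eval F.interp σ u) ⟧ ≈ ⟦ u ⟧
        eval-σ u u⊆s = A.trans (eval-fibre σ u)
          (eval-[]-fix A ρ u (override-∈ (var∈? s) var s ∘′ u⊆s))

        f-s : ∀ u → Var u ⊆ Var s → Var s ⊆ Var u → ⟦ f⟨ u , s ⟩ ⟧ ≈ ⟦ u ⟧
        f-s u u⊆s s⊆u = A∈RV (f⟨ u , s ⟩ ≋ u)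
          ([ id , s⊆u ]′ ∘′ Var-f⁻ u s , Var-f⁺ u s ∘′ inj₁) (f-absorbs u s) ρ

    R-meet : ∀ (U W : Variety τ) → class U ⊆′ class V → class W ⊆′ class V →
             class (meet (R U) (R W)) ⊆′ class (R (meet U W))
    -- The fibre is taken over the left side of the regular identity to be checked, at the given
    -- assignment.
    R-meet U W U⊆V W⊆V A (A∈RU , A∈RW) (s ≋ t) s≐t s≈t ρ =
      fibre-reflects t s≐t (s≈t fibre (fibre∈ U U⊆V A∈RU , fibre∈ W W⊆V A∈RW))
      where open Fibre A (R-mono U V U⊆V A A∈RU) ρ s

  -- Preservation of joins, and the lattice embedding.

  R-join : ∀ (U W : Variety τ) → class (R (join U W)) ⊆′ class (join (R U) (R W))
  -- A common identity of `R U` and `R W` is regular and holds in `U` and `W`, so it is a regular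
  -- identity of their join.
  R-join U W A A∈ i RU⊩i RW⊩i = A∈ i (R-regular U i RU⊩i)
    (λ B B∈ → B∈ i (λ D D∈U → RU⊩i D (V⊆R U D D∈U)) (λ D D∈W → RW⊩i D (V⊆R W D D∈W)))

  h-isLatticeMonomorphism : ∀ (V : Variety τ) → StronglyIrregular V →
    LatticeMorphisms.IsLatticeMonomorphism (rawLattice (𝐋 V)) (rawLattice (𝐋 (R V))) (h V)
  h-isLatticeMonomorphism V (f , f≐ , f≈x) = record
    { isLatticeHomomorphism = record
      { isRelHomomorphism = record
        { cong = λ { {U , _} {W , _} (U⊆W , W⊆U) → R-mono U W U⊆W , R-mono W U W⊆U } }
      ; ∧-homo = λ { (U , U⊆V) (W , W⊆V) →
            (λ A A∈ → R-mono (meet U W) U (λ _ → proj₁) A A∈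
                    , R-mono (meet U W) W (λ _ → proj₂) A A∈)
          , R-meet U W U⊆V W⊆V }
      ; ∨-homo = λ { (U , _) (W , _) →
            R-join U W
          , join-least (R U) (R W) (R (join U W))
              (R-mono U (join U W) (λ A A∈U i U⊩i _ → U⊩i A A∈U))
              (R-mono W (join U W) (λ A A∈W i _ W⊩i → W⊩i A A∈W)) }
      }
    ; injective = λ { {U , U⊆V} {W , W⊆V} (RU⊆RW , RW⊆RU) →
          h-injective U W U⊆V W⊆V RU⊆RW
        , h-injective W U W⊆V U⊆V RW⊆RU }
    }
    where open StrongIrregularity V f f≐ f≈x

theorem4 : ∀ {ℓ : Level} (τ : AlgebraicType ℓ) → Plural τ → (V : Variety τ) →
    (Irregular V → (W : Subvariety V) →
    Covers (Lattice.poset (𝐋 (R V))) (h V W) (asSubvariety V W))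
    ×
    (StronglyIrregular V →
    LatticeMorphisms.IsLatticeMonomorphism (rawLattice (𝐋 V)) (rawLattice (𝐋 (R V))) (h V))
theorem4 τ plural V = R-covers plural V , h-isLatticeMonomorphism V
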